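{- Let $q$ be a power of $2$ and let $r,s$ be positive integers with $s\equiv r+2\pmod{q+1}$. Let $B(x)\in\mathbb{F}_{q^2}[x]$ be such that $B(x)$ has no root in $\mu_{q+1}$ and $x\mapsto x^{r}B^{(q)}(1/x)/B(x)$ permutes $\mu_{q+1}$. Let $a\in\mathbb{F}_{q^2}\setminus\mathbb{F}_q$ and $b\in\mathbb{F}_q^{*}$. Then $$x^{s}B(x^{q-1})\left(ax^{2(q-1)}+bx^{q-1}+a^{q}\right)$$ permutes $\mathbb{F}_{q^2}$ if and only if $\gcd(s,q-1)=1$ and $\mathrm{Tr}\left(\frac{a^{q+1}}{b^{2}}\right)\neq 1$.
   Context: $\mu_{q+1}$ denotes the set of $(q+1)$-th roots of unity in $\mathbb{F}_{q^2}$. For $B(x)\in\mathbb{F}_{q^2}[x]$, $B^{(q)}(x)$ denotes the polynomial obtained from $B(x)$ by raising every coefficient to the $q$-th power. $\mathrm{Tr}$ is the absolute trace $\mathbb{F}_q\to\mathbb{F}_2$, $\mathrm{Tr}(x)=x+x^2+x^{2^2}+\cdots+x^{2^{m-1}}$ where $q=2^m$. A polynomial permutes a finite set if it induces a bijection of that set onto itself. -}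

module Defs where

open import Algebra.Bundles using (CommutativeRing)
import Algebra.Definitions.RawMonoid as RawMonoid
import Algebra.Properties.Semiring.Exp as Exp
open import Data.Fin using (Fin; toℕ)
open import Data.List using (List; foldr; map)
open import Data.Nat as ℕ using (ℕ)
open import Data.Product using (Σ; _,_; proj₁)
open import Function using (_on_)
open import Function.Bundles using (Inverse)
open import Function.Definitions using (Bijective)
open import Level using (Level; suc; _⊔_)
open import Relation.Binary.PropositionalEquality using (setoid)
open import Relation.Nullary using (¬_)

-- The fields of interest are finite, hence have decidable equality, so
-- inversion can be a total operation with the convention 0 ⁻¹ ≈ 0.
record Field (c ℓ : Level) : Set (suc (c ⊔ ℓ)) where
  infix  8 _⁻¹
  infixl 7 _/_
  field
    commutativeRing : CommutativeRing c ℓ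

  open CommutativeRing commutativeRing public
  open Exp semiring public using (_^_)

  field
    0≉1         : ¬ (0# ≈ 1#)
    _⁻¹         : Carrier → Carrier
    ⁻¹-cong     : ∀ {x y} → x ≈ y → x ⁻¹ ≈ y ⁻¹
    ⁻¹-inverseʳ : ∀ {x} → ¬ (x ≈ 0#) → x * x ⁻¹ ≈ 1#
    0⁻¹≈0       : 0# ⁻¹ ≈ 0#

  _/_ : Carrier → Carrier → Carrier
  x / y = x * y ⁻¹

HasOrder : ∀ {c ℓ} → Field c ℓ → ℕ → Set (c ⊔ ℓ)
HasOrder F n = Inverse (Field.setoid F) (setoid (Fin n))

module FieldNotions {c ℓ : Level} (F : Field c ℓ) where
  open Field F hiding (setoid)
  open RawMonoid +-rawMonoid using (sum)

  -- Coefficients in order of increasing degree; trailing zeros are allowed.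
  Poly : Set c
  Poly = List Carrier

  eval : Poly → Carrier → Carrier
  eval B x = foldr (λ coeff rest → coeff + x * rest) 0# B

  _⁽_⁾ : Poly → ℕ → Poly
  B ⁽ q ⁾ = map (_^ q) B

  μ : ℕ → Carrier → Set ℓ
  μ n x = x ^ n ≈ 1#

  PermutesOn : ∀ {p} → (Carrier → Set p) → (Carrier → Carrier) → Set (c ⊔ ℓ ⊔ p)
  PermutesOn P f =
    Σ (∀ {x} → P x → P (f x)) λ closed →
      Bijective {A = Σ Carrier P} {B = Σ Carrier P}
        (_≈_ on proj₁) (_≈_ on proj₁) (λ (x , px) → f x , closed px)

  Permutes : (Carrier → Carrier) → Set (c ⊔ ℓ)
  Permutes f = Bijective _≈_ _≈_ f

  -- On the subfield with 2 ^ m elements this is the absolute trace, whose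
  -- values lie in the prime field {0# , 1#}.  The formula is used inside the
  -- larger field F, at elements of that subfield.
  Tr : ℕ → Carrier → Carrier
  Tr m x = sum {m} (λ i → x ^ (2 ℕ.^ toℕ i))

{-# OPTIONS --safe #-}

-- Write h(y) = B(y)(a y² + b y + a^q), so that the polynomial is f(x) = x^s h(x^(q-1)).  On μ the
-- factor P(y) = a y² + b y + a^q satisfies y² P(y)^q = P(y), so when P has no root in μ the
-- (q-1)-st power of f(x) is y^r B^(q)(1/y) / B(y) with y = x^(q-1): the given permutation of μ
-- determines y from f(x), and then x is determined by x^s and x^(q-1), provided these exponents are coprime.
-- Conversely a common divisor of s and q - 1 yields a root of unity ω ≠ 1 with f(ω) = f(1), and a
-- root of P in μ yields x ≠ 0 with f(x) = 0 = f(0).  Finally P has a root in μ exactly when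
-- Tr(a^(q+1) / b²) = 1.
module Submission where

open import Defs
open import Algebra.Morphism.Structures using (IsRingMonomorphism)
import Algebra.Properties.CommutativeMonoid.Sum as Sum
import Algebra.Properties.CommutativeSemiring.Exp as Exp
import Algebra.Properties.Group as GroupProperties
import Algebra.Properties.Ring as RingProperties
import Algebra.Properties.Semiring.Mult as Mult
import Algebra.Solver.Ring.NaturalCoefficients.Default as Solver
open import Data.Empty using (⊥-elim)
open import Data.Fin as Fin using (Fin; zero; suc; toℕ; punchIn; punchOut; inject≤)
open import Data.Fin.Permutation using (Permutation′; permutation; _⟨$⟩ʳ_)
import Data.Fin.Properties as Fin
open import Data.List using ([]; _∷_)
open import Data.Nat as ℕ using (ℕ; zero; suc; _∸_; _>_; _%_; z≤n; s≤s)
open import Data.Nat.Divisibility using (_∣_; divides; ∣-trans; m∣m*n)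
open import Data.Nat.DivMod using (m≡m%n+[m/n]*n)
open import Data.Nat.GCD using (gcd; GCD; gcd-GCD; gcd[m,n]∣m; gcd[m,n]∣n; module Bézout)
import Data.Nat.Properties as ℕ
import Data.Nat.Solver as ℕSolver
open import Data.Product using (∃; ∃₂; _×_; _,_; proj₁; proj₂)
open import Data.Vec.Functional using (replicate)
open import Function.Base using (_∘_)
open import Function.Bundles using (_⇔_; Inverse; mk⇔)
open import Function.Definitions using (Injective; Surjective)
open import Relation.Binary.Definitions using (Decidable)
import Relation.Binary.PropositionalEquality as ≡
open ≡ using (_≡_; _≢_)
open import Relation.Nullary using (¬_; Dec; yes; no; ¬?)
open import Relation.Nullary.Decidable using (map′; decidable-stable)

-- Pigeonhole: if `j` were missed, punching it out of the codomain would give an injection into a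
-- set with one element fewer.
injective⇒surjective : ∀ {n} {f : Fin n → Fin n} → Injective _≡_ _≡_ f → ∀ j → ∃ λ i → f i ≡ j
injective⇒surjective {n = suc n} {f} f-injective j with Fin.any? (λ i → f i Fin.≟ j)
... | yes hit = hit
... | no miss = ⊥-elim (ℕ.1+n≰n (Fin.injective⇒≤ {f = λ i → punchOut (j≢f i)}
                  (λ {i k} eq → f-injective (Fin.punchOut-injective (j≢f i) (j≢f k) eq))))
  where
  j≢f : ∀ i → j ≢ f i
  j≢f i j≡fi = miss (i , ≡.sym j≡fi)

-- Powers, inverses and cancellation in a field.

module FieldProperties {c ℓ} (F : Field c ℓ) where
  open Field F hiding (zero)
  open Exp commutativeSemiring public
    using (^-congˡ; ^-congʳ; ^-homo-*; ^-assocʳ; ^-distrib-*)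
  open import Relation.Binary.Reasoning.Setoid setoid
  open Solver commutativeSemiring
  open GroupProperties +-group using (inverseˡ-unique)
  open RingProperties ring using (-‿distribˡ-*; -1*x≈-x; -‿involutive)

  ^-swap : ∀ x m n → (x ^ m) ^ n ≈ (x ^ n) ^ m
  ^-swap x m n = begin
    (x ^ m) ^ n    ≈⟨ ^-assocʳ x m n ⟩
    x ^ (m ℕ.* n)  ≈⟨ ^-congʳ x (ℕ.*-comm m n) ⟩
    x ^ (n ℕ.* m)  ≈⟨ ^-assocʳ x n m ⟨
    (x ^ n) ^ m    ∎

  1^n≈1 : ∀ n → 1# ^ n ≈ 1#
  1^n≈1 zero    = refl
  1^n≈1 (suc n) = trans (*-identityˡ _) (1^n≈1 n)

  0^n≈0 : ∀ {n x} → n > 0 → x ≈ 0# → x ^ n ≈ 0#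
  0^n≈0 {suc n} _ x≈0 = trans (*-congʳ x≈0) (zeroˡ _)

  *-cancelˡ-≉0 : ∀ {x y z} → ¬ (x ≈ 0#) → x * y ≈ x * z → y ≈ z
  *-cancelˡ-≉0 {x} {y} {z} x≉0 xy≈xz = begin
    y             ≈⟨ *-identityˡ y ⟨
    1# * y        ≈⟨ *-congʳ (⁻¹-inverseʳ x≉0) ⟨
    x * x ⁻¹ * y  ≈⟨ solve 3 (λ a b c → a :* b :* c := b :* (a :* c)) refl x (x ⁻¹) y ⟩
    x ⁻¹ * (x * y) ≈⟨ *-congˡ xy≈xz ⟩
    x ⁻¹ * (x * z) ≈⟨ solve 3 (λ a b c → b :* (a :* c) := a :* b :* c) refl x (x ⁻¹) z ⟩
    x * x ⁻¹ * z  ≈⟨ *-congʳ (⁻¹-inverseʳ x≉0) ⟩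
    1# * z        ≈⟨ *-identityˡ z ⟩
    z             ∎

  *-≉0 : ∀ {x y} → ¬ (x ≈ 0#) → ¬ (y ≈ 0#) → ¬ (x * y ≈ 0#)
  *-≉0 x≉0 y≉0 xy≈0 = y≉0 (*-cancelˡ-≉0 x≉0 (trans xy≈0 (sym (zeroʳ _))))

  ^-≉0 : ∀ {x} n → ¬ (x ≈ 0#) → ¬ (x ^ n ≈ 0#)
  ^-≉0 zero    x≉0 1≈0 = 0≉1 (sym 1≈0)
  ^-≉0 (suc n) x≉0 = *-≉0 x≉0 (^-≉0 n x≉0)

  unit⇒≉0 : ∀ {x y} → x * y ≈ 1# → ¬ (x ≈ 0#)
  unit⇒≉0 xy≈1 x≈0 = 0≉1 (trans (sym (trans (*-congʳ x≈0) (zeroˡ _))) xy≈1)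

  ⁻¹-unique : ∀ {x y} → x * y ≈ 1# → y ≈ x ⁻¹
  ⁻¹-unique xy≈1 = *-cancelˡ-≉0 (unit⇒≉0 xy≈1)
    (trans xy≈1 (sym (⁻¹-inverseʳ (unit⇒≉0 xy≈1))))

  ⁻¹-^ : ∀ {x} n → ¬ (x ≈ 0#) → (x ⁻¹) ^ n ≈ (x ^ n) ⁻¹
  ⁻¹-^ {x} n x≉0 = ⁻¹-unique (begin
    x ^ n * (x ⁻¹) ^ n  ≈⟨ ^-distrib-* x (x ⁻¹) n ⟨
    (x * x ⁻¹) ^ n      ≈⟨ ^-congˡ n (⁻¹-inverseʳ x≉0) ⟩
    1# ^ n              ≈⟨ 1^n≈1 n ⟩
    1#                  ∎)

  x^n≈x^[n%k] : ∀ {x} k n → x ^ suc k ≈ 1# → x ^ n ≈ x ^ (n % suc k)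
  x^n≈x^[n%k] {x} k n x^k≈1 = begin
    x ^ n                                              ≈⟨ ^-congʳ x (m≡m%n+[m/n]*n n (suc k)) ⟩
    x ^ (n % suc k ℕ.+ n ℕ./ suc k ℕ.* suc k)          ≈⟨ ^-homo-* x (n % suc k) _ ⟩
    x ^ (n % suc k) * x ^ (n ℕ./ suc k ℕ.* suc k)      ≈⟨ *-congˡ (begin
      x ^ (n ℕ./ suc k ℕ.* suc k)   ≈⟨ ^-assocʳ x (n ℕ./ suc k) (suc k) ⟨
      (x ^ (n ℕ./ suc k)) ^ suc k   ≈⟨ ^-swap x (n ℕ./ suc k) (suc k) ⟩
      (x ^ suc k) ^ (n ℕ./ suc k)   ≈⟨ ^-congˡ (n ℕ./ suc k) x^k≈1 ⟩
      1# ^ (n ℕ./ suc k)            ≈⟨ 1^n≈1 (n ℕ./ suc k) ⟩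
      1#                            ∎) ⟩
    x ^ (n % suc k) * 1#                               ≈⟨ *-identityʳ _ ⟩
    x ^ (n % suc k)                                    ∎

  ^-∣ : ∀ {ω d n} → d ∣ n → ω ^ d ≈ 1# → ω ^ n ≈ 1#
  ^-∣ {ω} {d} {n} (divides k n≡kd) ω^d≈1 = begin
    ω ^ n           ≈⟨ ^-congʳ ω n≡kd ⟩
    ω ^ (k ℕ.* d)   ≈⟨ ^-assocʳ ω k d ⟨
    (ω ^ k) ^ d     ≈⟨ ^-swap ω k d ⟩
    (ω ^ d) ^ k     ≈⟨ ^-congˡ k ω^d≈1 ⟩
    1# ^ k          ≈⟨ 1^n≈1 k ⟩
    1#              ∎

  -- The Bézout relation is kept in natural numbers, with the negative term moved across:
  -- multiplying `z` by `(z ^ n) ^ v` gives `(z ^ k) ^ u`, and the nonzero factor cancels.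
  ^-injective-bézout : ∀ k n u v → 1 ℕ.+ v ℕ.* n ≡ u ℕ.* k → ∀ {x y} → ¬ (x ≈ 0#) →
                       x ^ k ≈ y ^ k → x ^ n ≈ y ^ n → x ≈ y
  ^-injective-bézout k n u v 1+vn≡uk {x} {y} x≉0 eqₖ eqₙ = *-cancelˡ-≉0 (^-≉0 v (^-≉0 n x≉0)) (begin
    (x ^ n) ^ v * x    ≈⟨ expand x ⟩
    (x ^ k) ^ u        ≈⟨ ^-congˡ u eqₖ ⟩
    (y ^ k) ^ u        ≈⟨ expand y ⟨
    (y ^ n) ^ v * y    ≈⟨ *-congʳ (^-congˡ v eqₙ) ⟨
    (x ^ n) ^ v * y    ∎)
    where
    expand : ∀ z → (z ^ n) ^ v * z ≈ (z ^ k) ^ u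
    expand z = begin
      (z ^ n) ^ v * z        ≈⟨ *-comm _ _ ⟩
      z * (z ^ n) ^ v        ≈⟨ *-congˡ (trans (^-swap z n v) (^-assocʳ z v n)) ⟩
      z ^ (1 ℕ.+ v ℕ.* n)    ≈⟨ ^-congʳ z 1+vn≡uk ⟩
      z ^ (u ℕ.* k)          ≈⟨ trans (sym (^-assocʳ z u k)) (^-swap z u k) ⟩
      (z ^ k) ^ u            ∎

  ^-injective-coprime : ∀ {k n} → gcd k n ≡ 1 → ∀ {x y} → ¬ (x ≈ 0#) →
                        x ^ k ≈ y ^ k → x ^ n ≈ y ^ n → x ≈ y
  ^-injective-coprime {k} {n} gcd≡1 x≉0 eqₖ eqₙ
    with Bézout.identity (≡.subst (GCD k n) gcd≡1 (gcd-GCD k n))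
  ... | Bézout.+- u v 1+vn≡uk = ^-injective-bézout k n u v 1+vn≡uk x≉0 eqₖ eqₙ
  ... | Bézout.-+ u v 1+uk≡vn = ^-injective-bézout n k v u 1+uk≡vn x≉0 eqₙ eqₖ

  -- Monic polynomial functions and the number of their roots.

  -- Horner form of a function up to pointwise equality. The leading coefficient 1 is the base case,
  -- so no coefficient has to be tested for zero.
  Monic : ℕ → (Carrier → Carrier) → Set _
  Monic zero    f = ∀ x → f x ≈ 1#
  Monic (suc n) f = ∃₂ λ c g → Monic n g × (∀ x → f x ≈ c + x * g x)

  -- A summand of lower degree leaves the leading coefficient alone. This keeps the quotient in
  -- `monic-divide` monic.
  monic-+* : ∀ n {g h} k → Monic (suc n) g → Monic n h → Monic (suc n) (λ x → g x + k * h x)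
  monic-+* zero {g} {h} k (c , g′ , g′≈1 , g≈) h≈1 = c + k , g′ , g′≈1 , λ x → begin
    g x + k * h x         ≈⟨ +-cong (g≈ x) (trans (*-congˡ (h≈1 x)) (*-identityʳ k)) ⟩
    c + x * g′ x + k      ≈⟨ solve 3 (λ c y k → c :+ y :+ k := c :+ k :+ y) refl c (x * g′ x) k ⟩
    c + k + x * g′ x      ∎
  monic-+* (suc n) {g} {h} k (c , g′ , g′-monic , g≈) (d , h′ , h′-monic , h≈) =
    c + k * d , _ , monic-+* n k g′-monic h′-monic , λ x → begin
    g x + k * h x                               ≈⟨ +-cong (g≈ x) (*-congˡ (h≈ x)) ⟩
    c + x * g′ x + k * (d + x * h′ x)
      ≈⟨ solve 6 (λ c d k x u v → c :+ x :* u :+ k :* (d :+ x :* v)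
                    := c :+ k :* d :+ x :* (u :+ k :* v)) refl c d k x (g′ x) (h′ x) ⟩
    c + k * d + x * (g′ x + k * h′ x)           ∎

  -- f(x) = f(k) + (x − k) g(x), with the subtraction moved to the other side.
  monic-divide : ∀ n {f} k → Monic (suc n) f →
                 ∃ λ g → Monic n g × (∀ x → f x + k * g x ≈ f k + x * g x)
  monic-divide zero {f} k (c , g , g≈1 , f≈) = g , g≈1 , λ x → begin
    f x + k * g x               ≈⟨ +-cong (f≈ x) (*-congˡ (trans (g≈1 x) (sym (g≈1 k)))) ⟩
    c + x * g x + k * g k       ≈⟨ solve 3 (λ c y z → c :+ y :+ z := c :+ z :+ y) refl c (x * g x) (k * g k) ⟩
    c + k * g k + x * g x       ≈⟨ +-congʳ (f≈ k) ⟨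
    f k + x * g x               ∎
  monic-divide (suc n) {f} k (c , g , g-monic , f≈) with monic-divide n k g-monic
  ... | h , h-monic , g≈ = (λ x → g x + k * h x) , monic-+* n k g-monic h-monic , λ x → begin
    f x + k * (g x + k * h x)               ≈⟨ +-cong (f≈ x) (*-congˡ (g≈ x)) ⟩
    c + x * g x + k * (g k + x * h x)
      ≈⟨ solve 6 (λ c x k u v w → c :+ x :* u :+ k :* (v :+ x :* w)
                    := c :+ k :* v :+ x :* (u :+ k :* w)) refl c x k (g x) (g k) (h x) ⟩
    c + k * g k + x * (g x + k * h x)       ≈⟨ +-congʳ (f≈ k) ⟨
    f k + x * (g x + k * h x)               ∎

  -- Divide by x - k for the first root k: the other points are roots of the quotient, of degree one
  -- less, until the constant 1 would have to vanish.
  monic-roots : ∀ n {f} → Monic n f → (xs : Fin (suc n) → Carrier) →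
                Injective _≡_ _≈_ xs → ¬ (∀ i → f (xs i) ≈ 0#)
  monic-roots zero f≈1 xs inj roots = 0≉1 (trans (sym (roots zero)) (f≈1 _))
  monic-roots (suc n) {f} f-monic xs inj roots with monic-divide n (xs zero) f-monic
  ... | g , g-monic , f≈ = monic-roots n g-monic (xs ∘ suc) (Fin.suc-injective ∘ inj) g-root
    where
    k = xs zero
    g-root : ∀ i → g (xs (suc i)) ≈ 0#
    g-root i = *-cancelˡ-≉0 {x = x + - k} x≉k (begin
      (x + - k) * g x              ≈⟨ distribʳ _ _ _ ⟩
      x * g x + - k * g x          ≈⟨ +-cong x*gx≈k*gx (sym (-‿distribˡ-* k (g x))) ⟩
      k * g x + - (k * g x)        ≈⟨ -‿inverseʳ _ ⟩
      0#                           ≈⟨ zeroʳ _ ⟨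
      (x + - k) * 0#               ∎)
      where
      x = xs (suc i)
      x≉k : ¬ (x + - k ≈ 0#)
      -- If x = k, injectivity of `xs` would identify the indices `suc i` and `zero`.
      x≉k x-k≈0 with () ← inj (trans (inverseˡ-unique _ _ x-k≈0) (-‿involutive k))
      x*gx≈k*gx : x * g x ≈ k * g x
      x*gx≈k*gx = begin
        x * g x          ≈⟨ +-identityˡ _ ⟨
        0# + x * g x     ≈⟨ +-congʳ (roots zero) ⟨
        f k + x * g x    ≈⟨ f≈ x ⟨
        f x + k * g x    ≈⟨ +-congʳ (roots (suc i)) ⟩
        0# + k * g x     ≈⟨ +-identityˡ _ ⟩
        k * g x          ∎

  ^-monic : ∀ n → Monic n (_^ n)
  ^-monic zero    x = refl
  ^-monic (suc n) = 0# , (_^ n) , ^-monic n , λ x → sym (+-identityˡ _)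

  -- The fixed points are roots of x(x^(1+e) - 1), which is monic of degree 2 + e.
  power-fixpoints : ∀ e (xs : Fin (3 ℕ.+ e) → Carrier) → Injective _≡_ _≈_ xs →
                    ¬ (∀ i → xs i ^ (2 ℕ.+ e) ≈ xs i)
  power-fixpoints e xs inj fixed =
    monic-roots (2 ℕ.+ e) {λ x → x * (- 1# + x ^ suc e)}
      (0# , _ , (- 1# , _ , ^-monic e , λ x → refl) , λ x → sym (+-identityˡ _)) xs inj
      λ i → let x = xs i in begin
        x * (- 1# + x ^ suc e)        ≈⟨ distribˡ _ _ _ ⟩
        x * - 1# + x ^ (2 ℕ.+ e)      ≈⟨ +-cong (trans (*-comm _ _) (-1*x≈-x x)) (fixed i) ⟩
        - x + x                       ≈⟨ -‿inverseˡ x ⟩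
        0#                            ∎

CharTwo : ∀ {c ℓ} → Field c ℓ → Set ℓ
CharTwo F = let open Field F in 1# + 1# ≈ 0#

-- Finite fields: characteristic, Fermat's theorem and roots of unity.

module FiniteField {c ℓ} (F : Field c ℓ) where
  open Field F hiding (zero)
  open FieldProperties F
  open import Relation.Binary.Reasoning.Setoid setoid
  open Mult semiring using (×-congˡ; ×-homo-1; ×1-homo-*) renaming (_×_ to _·_)
  private
    module S = Sum +-commutativeMonoid
    module P = Sum *-commutativeMonoid

  module _ {n} (order : HasOrder F n) where
    open Inverse order

    index-injective : ∀ {x y} → to x ≡ to y → x ≈ y
    index-injective eq = trans (sym (strictlyInverseʳ _)) (trans (from-cong eq) (strictlyInverseʳ _))

    from-injective : Injective _≡_ _≈_ from
    from-injective eq = ≡.trans (≡.sym (strictlyInverseˡ _)) (≡.trans (to-cong eq) (strictlyInverseˡ _))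

    _≟_ : Decidable _≈_
    x ≟ y = map′ index-injective to-cong (to x Fin.≟ to y)

    injective⇒bijective : ∀ {f} → (∀ {x y} → x ≈ y → f x ≈ f y) → Injective _≈_ _≈_ f →
                          Injective _≈_ _≈_ f × Surjective _≈_ _≈_ f
    injective⇒bijective {f} f-cong f-inj = f-inj , surj
      where
      surj : Surjective _≈_ _≈_ f
      surj y with injective⇒surjective {f = to ∘ f ∘ from}
                    (from-injective ∘ f-inj ∘ index-injective) (to y)
      ... | i , eq = from i , λ z≈ → trans (f-cong z≈) (index-injective eq)

    module _ (σ τ : Carrier → Carrier)
             (σ-cong : ∀ {x y} → x ≈ y → σ x ≈ σ y) (τ-cong : ∀ {x y} → x ≈ y → τ x ≈ τ y)
             (στ : ∀ x → σ (τ x) ≈ x) (τσ : ∀ x → τ (σ x) ≈ x) where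

      indexPermutation : Permutation′ n
      indexPermutation = permutation (to ∘ σ ∘ from) (to ∘ τ ∘ from)
        (λ i → ≡.trans (to-cong (trans (σ-cong (strictlyInverseʳ _)) (στ _))) (strictlyInverseˡ i))
        (λ i → ≡.trans (to-cong (trans (τ-cong (strictlyInverseʳ _)) (τσ _))) (strictlyInverseˡ i))

    -- Translation by 1 permutes the field, so the sum of all elements is unchanged when 1 is added
    -- to each of the n terms.
    order·1≈0 : n · 1# ≈ 0#
    order·1≈0 = identityʳ-unique (S.sum from) (n · 1#) (begin
      S.sum from + n · 1#                       ≈⟨ +-congˡ (S.sum-replicate n) ⟨
      S.sum from + S.sum (replicate n 1#)       ≈⟨ S.∑-distrib-+ from (replicate n 1#) ⟨
      S.sum (λ i → from i + 1#)                 ≈⟨ S.sum-cong-≋ {n} (λ i → strictlyInverseʳ (from i + 1#)) ⟨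
      S.sum (λ i → from (π ⟨$⟩ʳ i))             ≈⟨ S.sum-permute from π ⟨
      S.sum from                                ∎)
      where
      open GroupProperties +-group using (identityʳ-unique)
      π = indexPermutation (_+ 1#) (_+ - 1#) +-congʳ +-congʳ
        (λ x → trans (+-assoc _ _ _) (trans (+-congˡ (-‿inverseˡ 1#)) (+-identityʳ x)))
        (λ x → trans (+-assoc _ _ _) (trans (+-congˡ (-‿inverseʳ 1#)) (+-identityʳ x)))

    -- With y running over the field, zero contributes the factor 1, so a product over the nonzero
    -- elements can be taken over all of `Fin n`.
    unlessZero : Carrier → Carrier → Carrier
    unlessZero x y with y ≟ 0#
    ... | yes _ = 1#
    ... | no _  = x

    unlessZero-zero : ∀ {x y} → y ≈ 0# → unlessZero x y ≈ 1#
    unlessZero-zero {x} {y} y≈0 with y ≟ 0#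
    ... | yes _  = refl
    ... | no y≉0 = ⊥-elim (y≉0 y≈0)

    unlessZero-nonzero : ∀ {x y} → ¬ (y ≈ 0#) → unlessZero x y ≈ x
    unlessZero-nonzero {x} {y} y≉0 with y ≟ 0#
    ... | yes y≈0 = ⊥-elim (y≉0 y≈0)
    ... | no _  = refl

    product-≉0 : ∀ {k} (f : Fin k → Carrier) → (∀ i → ¬ (f i ≈ 0#)) → ¬ (P.sum f ≈ 0#)
    product-≉0 {zero}  f f≉0 1≈0 = 0≉1 (sym 1≈0)
    product-≉0 {suc k} f f≉0 = *-≉0 (f≉0 zero) (product-≉0 (f ∘ suc) (f≉0 ∘ suc))

    private
      φ : Carrier → Carrier
      φ y = unlessZero y y

      φ-cong : ∀ {x y} → x ≈ y → φ x ≈ φ y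
      φ-cong {x} {y} x≈y with x ≟ 0#
      ... | yes x≈0 = sym (unlessZero-zero (trans (sym x≈y) x≈0))
      ... | no x≉0 = trans x≈y (sym (unlessZero-nonzero (x≉0 ∘ trans x≈y)))

      φ≉0 : ∀ y → ¬ (φ y ≈ 0#)
      φ≉0 y with y ≟ 0#
      ... | yes _  = 0≉1 ∘ sym
      ... | no y≉0 = y≉0

      φ-* : ∀ {x} → ¬ (x ≈ 0#) → ∀ y → φ (x * y) ≈ unlessZero x y * φ y
      φ-* {x} x≉0 y with y ≟ 0#
      ... | yes y≈0 = trans (unlessZero-zero (trans (*-congˡ y≈0) (zeroʳ x))) (sym (*-identityˡ 1#))
      ... | no y≉0 = unlessZero-nonzero (*-≉0 x≉0 y≉0)

    -- Multiplication by x permutes the nonzero elements, so it preserves their product.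
    ∏-unlessZero : ∀ {x} → ¬ (x ≈ 0#) → P.sum (λ i → unlessZero x (from i)) ≈ 1#
    ∏-unlessZero {x} x≉0 = *-cancelˡ-≉0 (product-≉0 (φ ∘ from) (φ≉0 ∘ from)) (begin
      P.sum (φ ∘ from) * P.sum (λ i → unlessZero x (from i)) ≈⟨ *-comm _ _ ⟩
      P.sum (λ i → unlessZero x (from i)) * P.sum (φ ∘ from) ≈⟨ P.∑-distrib-+ _ (φ ∘ from) ⟨
      P.sum (λ i → unlessZero x (from i) * φ (from i))       ≈⟨ P.sum-cong-≋ (φ-* x≉0 ∘ from) ⟨
      P.sum (λ i → φ (x * from i))         ≈⟨ P.sum-cong-≋ {n} (λ i → φ-cong (strictlyInverseʳ (x * from i))) ⟨
      P.sum (λ i → φ (from (π ⟨$⟩ʳ i)))    ≈⟨ P.sum-permute (φ ∘ from) π ⟨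
      P.sum (φ ∘ from)                     ≈⟨ *-identityʳ _ ⟨
      P.sum (φ ∘ from) * 1#                ∎)
      where
      cancel : ∀ {u v} → u * v ≈ 1# → ∀ y → u * (v * y) ≈ y
      cancel uv≈1 y = trans (sym (*-assoc _ _ _)) (trans (*-congʳ uv≈1) (*-identityˡ y))
      π = indexPermutation (x *_) (x ⁻¹ *_) *-congˡ *-congˡ (cancel (⁻¹-inverseʳ x≉0))
            (cancel (trans (*-comm _ _) (⁻¹-inverseʳ x≉0)))

  -- In the product of `∏-unlessZero`, the index of zero contributes 1 and each of the n remaining
  -- indices contributes x.
  x^[n-1]≈1 : ∀ {n} → HasOrder F (suc n) → ∀ {x} → ¬ (x ≈ 0#) → x ^ n ≈ 1#
  x^[n-1]≈1 {n} order {x} x≉0 = begin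
    x ^ n                                  ≈⟨ P.sum-replicate n ⟨
    P.sum (replicate n x)                  ≈⟨ P.sum-cong-≋ (λ j → unlessZero-nonzero order (rest≉0 j)) ⟨
    P.sum (λ j → ψ (punchIn 0̂ j))          ≈⟨ *-identityˡ _ ⟨
    1# * P.sum (λ j → ψ (punchIn 0̂ j))
      ≈⟨ *-congʳ (unlessZero-zero order (strictlyInverseʳ 0#)) ⟨
    ψ 0̂ * P.sum (λ j → ψ (punchIn 0̂ j))    ≈⟨ P.sum-remove {i = 0̂} ψ ⟨
    P.sum ψ                                ≈⟨ ∏-unlessZero order x≉0 ⟩
    1#                                     ∎
    where
    open Inverse order
    0̂ = to 0#
    ψ : Fin (suc n) → Carrier
    ψ i = unlessZero order x (from i)
    rest≉0 : ∀ j → ¬ (from (punchIn 0̂ j) ≈ 0#)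
    rest≉0 j eq = Fin.punchInᵢ≢i 0̂ j
      (from-injective order (trans eq (sym (strictlyInverseʳ 0#))))

  x^n≈x : ∀ {n} → HasOrder F n → ∀ x → x ^ n ≈ x
  x^n≈x {zero} order x with () ← Inverse.to order x
  x^n≈x {suc n} order x with _≟_ order x 0#
  ... | yes x≈0 = trans (*-congʳ x≈0) (trans (zeroˡ _) (sym x≈0))
  ... | no x≉0 = trans (*-congˡ (x^[n-1]≈1 order x≉0)) (*-identityʳ x)

  -- The order times 1 vanishes, but it is also the k-th power of 1 + 1, which would be nonzero if 1
  -- + 1 were.
  charTwo : ∀ k → HasOrder F (2 ℕ.^ k) → CharTwo F
  charTwo k order with _≟_ order (1# + 1#) 0#
  ... | yes eq = eq
  ... | no neq = ⊥-elim (2^k·1≉0 k (order·1≈0 order))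
    where
    2^k·1≉0 : ∀ k → ¬ ((2 ℕ.^ k) · 1# ≈ 0#)
    2^k·1≉0 zero    eq = 0≉1 (trans (sym eq) (×-homo-1 1#))
    2^k·1≉0 (suc k) eq = *-≉0 (neq ∘ trans (+-congˡ (sym (+-identityʳ 1#)))) (2^k·1≉0 k)
      (trans (sym (×1-homo-* 2 (2 ℕ.^ k))) eq)

  -- The power map fixes at most 2 + e elements and the field has more. Decidable equality lets a
  -- moved one be found by search.
  moved-by-power : ∀ {n} → HasOrder F n → ∀ e → 3 ℕ.+ e ℕ.≤ n → ∃ λ x → ¬ (x ^ (2 ℕ.+ e) ≈ x)
  moved-by-power order e 3+e≤n
    with Fin.any? (λ i → ¬? (_≟_ order (Inverse.from order i ^ (2 ℕ.+ e)) (Inverse.from order i)))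
  ... | yes (i , moved) = Inverse.from order i , moved
  ... | no none = ⊥-elim (power-fixpoints e (λ i → Inverse.from order (inject≤ i 3+e≤n))
      (Fin.inject≤-injective 3+e≤n 3+e≤n _ _ ∘ from-injective order)
      λ i → decidable-stable (_≟_ order _ _) λ moved → none (_ , moved))

  -- The witness is x^(n/(2+d)) for an x whose power of that exponent is not 1. Such an x exists
  -- because the exponent is smaller than n.
  root-of-unity : ∀ {n d} → HasOrder F (suc n) → n > 0 → 2 ℕ.+ d ∣ n →
                  ∃ λ ω → ω ^ (2 ℕ.+ d) ≈ 1# × ¬ (ω ≈ 1#)
  root-of-unity order () (divides zero ≡.refl)
  root-of-unity {n} {d} order n>0 (divides (suc k) n≡kd) = x ^ suc k , ω^d≈1 , λ ω≈1 →
      moved (trans (*-congˡ ω≈1) (*-identityʳ x))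
    where
    1+k<n : suc k ℕ.< n
    1+k<n = ≡.subst (suc k ℕ.<_) (≡.sym n≡kd) (ℕ.m<m*n (suc k) (2 ℕ.+ d) (s≤s (s≤s z≤n)))
    fix : ∃ λ x → ¬ (x ^ (2 ℕ.+ k) ≈ x)
    fix = moved-by-power order k (s≤s 1+k<n)
    x = proj₁ fix
    moved = proj₂ fix
    x≉0 : ¬ (x ≈ 0#)
    x≉0 x≈0 = moved (trans (0^n≈0 {2 ℕ.+ k} (s≤s z≤n) x≈0) (sym x≈0))
    ω^d≈1 : (x ^ suc k) ^ (2 ℕ.+ d) ≈ 1#
    ω^d≈1 = trans (^-assocʳ x (suc k) (2 ℕ.+ d))
      (trans (^-congʳ x (≡.sym n≡kd)) (x^[n-1]≈1 order x≉0))

-- Characteristic two: Frobenius, trace and the equation w² + w = u.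

module CharacteristicTwo {c ℓ} (F : Field c ℓ) (1+1≈0 : CharTwo F) where
  open Field F hiding (zero)
  open FieldProperties F
  open FieldNotions F
  open Solver commutativeSemiring
  open import Relation.Binary.Reasoning.Setoid setoid
  open Sum +-commutativeMonoid using (sum-cong-≋)

  x+x≈0 : ∀ x → x + x ≈ 0#
  x+x≈0 x = begin
    x + x            ≈⟨ +-cong (*-identityʳ x) (*-identityʳ x) ⟨
    x * 1# + x * 1#  ≈⟨ distribˡ x 1# 1# ⟨
    x * (1# + 1#)    ≈⟨ *-congˡ 1+1≈0 ⟩
    x * 0#           ≈⟨ zeroʳ x ⟩
    0#               ∎

  x+y+y≈x : ∀ x y → x + y + y ≈ x
  x+y+y≈x x y = trans (+-assoc x y y) (trans (+-congˡ (x+x≈0 y)) (+-identityʳ x))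

  x+y≈z⇒x≈z+y : ∀ {x y z} → x + y ≈ z → x ≈ z + y
  x+y≈z⇒x≈z+y x+y≈z = trans (sym (x+y+y≈x _ _)) (+-congʳ x+y≈z)

  x+y≈0⇒x≈y : ∀ {x y} → x + y ≈ 0# → x ≈ y
  x+y≈0⇒x≈y x+y≈0 = trans (x+y≈z⇒x≈z+y x+y≈0) (+-identityˡ _)

  ^2-+ : ∀ x y → (x + y) ^ 2 ≈ x ^ 2 + y ^ 2
  ^2-+ x y = begin
    (x + y) ^ 2
      ≈⟨ solve 2 (λ x y → (x :+ y) :^ 2 := x :^ 2 :+ y :^ 2 :+ x :* y :+ x :* y) refl x y ⟩
    x ^ 2 + y ^ 2 + x * y + x * y  ≈⟨ x+y+y≈x _ _ ⟩
    x ^ 2 + y ^ 2                  ∎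

  ^2^suc : ∀ n x → x ^ (2 ℕ.^ suc n) ≈ (x ^ 2) ^ (2 ℕ.^ n)
  ^2^suc n x = sym (^-assocʳ x 2 (2 ℕ.^ n))

  ^2^-+ : ∀ n x y → (x + y) ^ (2 ℕ.^ n) ≈ x ^ (2 ℕ.^ n) + y ^ (2 ℕ.^ n)
  ^2^-+ zero x y = trans (*-identityʳ _) (sym (+-cong (*-identityʳ x) (*-identityʳ y)))
  ^2^-+ (suc n) x y = begin
    (x + y) ^ (2 ℕ.^ suc n)                          ≈⟨ ^2^suc n _ ⟩
    ((x + y) ^ 2) ^ (2 ℕ.^ n)                        ≈⟨ ^-congˡ (2 ℕ.^ n) (^2-+ x y) ⟩
    (x ^ 2 + y ^ 2) ^ (2 ℕ.^ n)                      ≈⟨ ^2^-+ n _ _ ⟩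
    (x ^ 2) ^ (2 ℕ.^ n) + (y ^ 2) ^ (2 ℕ.^ n)        ≈⟨ +-cong (^2^suc n x) (^2^suc n y) ⟨
    x ^ (2 ℕ.^ suc n) + y ^ (2 ℕ.^ suc n)            ∎

  Tr-cong : ∀ n {x y} → x ≈ y → Tr n x ≈ Tr n y
  Tr-cong n x≈y = sum-cong-≋ {n} (λ i → ^-congˡ (2 ℕ.^ toℕ i) x≈y)

  Tr-suc : ∀ n x → Tr (suc n) x ≈ x + Tr n (x ^ 2)
  Tr-suc n x = +-cong (*-identityʳ x) (sum-cong-≋ {n} (λ i → ^2^suc (toℕ i) x))

  Tr-+ : ∀ n x y → Tr n (x + y) ≈ Tr n x + Tr n y
  Tr-+ zero    x y = sym (+-identityʳ 0#)
  Tr-+ (suc n) x y = begin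
    Tr (suc n) (x + y)                         ≈⟨ Tr-suc n _ ⟩
    x + y + Tr n ((x + y) ^ 2)                 ≈⟨ +-congˡ (Tr-cong n (^2-+ x y)) ⟩
    x + y + Tr n (x ^ 2 + y ^ 2)               ≈⟨ +-congˡ (Tr-+ n _ _) ⟩
    x + y + (Tr n (x ^ 2) + Tr n (y ^ 2))
      ≈⟨ solve 4 (λ x y u v → x :+ y :+ (u :+ v) := x :+ u :+ (y :+ v)) refl x y _ _ ⟩
    x + Tr n (x ^ 2) + (y + Tr n (y ^ 2))      ≈⟨ +-cong (Tr-suc n x) (Tr-suc n y) ⟨
    Tr (suc n) x + Tr (suc n) y                ∎

  Tr-^2 : ∀ n x → Tr n (x ^ 2) ≈ Tr n x ^ 2
  Tr-^2 zero    x = sym (zeroˡ _)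
  Tr-^2 (suc n) x = begin
    Tr (suc n) (x ^ 2)               ≈⟨ Tr-suc n _ ⟩
    x ^ 2 + Tr n ((x ^ 2) ^ 2)       ≈⟨ +-congˡ (Tr-^2 n _) ⟩
    x ^ 2 + Tr n (x ^ 2) ^ 2         ≈⟨ ^2-+ _ _ ⟨
    (x + Tr n (x ^ 2)) ^ 2           ≈⟨ ^-congˡ 2 (Tr-suc n x) ⟨
    Tr (suc n) x ^ 2                 ∎

  Tr-recurrence : ∀ n x → Tr (suc n) x ≈ x + Tr n x ^ 2
  Tr-recurrence n x = trans (Tr-suc n x) (+-congˡ (Tr-^2 n x))

  -- The sum telescopes. The identity holds for every x of the big field, where the two end terms
  -- need not cancel.
  Tr-x²+x : ∀ n x → Tr n (x ^ 2 + x) ≈ x ^ (2 ℕ.^ n) + x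
  Tr-x²+x zero    x = sym (trans (+-congʳ (*-identityʳ x)) (x+x≈0 x))
  Tr-x²+x (suc n) x = begin
    Tr (suc n) (x ^ 2 + x)                               ≈⟨ Tr-suc n _ ⟩
    x ^ 2 + x + Tr n ((x ^ 2 + x) ^ 2)                   ≈⟨ +-congˡ (Tr-cong n (^2-+ _ _)) ⟩
    x ^ 2 + x + Tr n ((x ^ 2) ^ 2 + x ^ 2)               ≈⟨ +-congˡ (Tr-x²+x n (x ^ 2)) ⟩
    x ^ 2 + x + ((x ^ 2) ^ (2 ℕ.^ n) + x ^ 2)
      ≈⟨ solve 3 (λ s x p → s :+ x :+ (p :+ s) := p :+ x :+ s :+ s) refl (x ^ 2) x _ ⟩
    (x ^ 2) ^ (2 ℕ.^ n) + x + x ^ 2 + x ^ 2              ≈⟨ x+y+y≈x _ _ ⟩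
    (x ^ 2) ^ (2 ℕ.^ n) + x                              ≈⟨ +-congʳ (^2^suc n x) ⟨
    x ^ (2 ℕ.^ suc n) + x                                ∎

  -- Peels off the highest power rather than the lowest, as needed for `hilbertSum`, which grows at
  -- that end. The shift from x to x² is corrected by the telescoping sum.
  Tr-last : ∀ n x → Tr (suc n) x ≈ Tr n x + x ^ (2 ℕ.^ n)
  Tr-last n x = begin
    Tr (suc n) x                           ≈⟨ Tr-recurrence n x ⟩
    x + Tr n x ^ 2                         ≈⟨ +-congˡ (Tr-^2 n x) ⟨
    x + Tr n (x ^ 2)
      ≈⟨ +-congˡ (x+y≈z⇒x≈z+y (trans (sym (Tr-+ n _ _)) (Tr-x²+x n x))) ⟩
    x + (x ^ (2 ℕ.^ n) + x + Tr n x)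
      ≈⟨ solve 3 (λ x p t → x :+ (p :+ x :+ t) := t :+ p :+ x :+ x) refl x _ _ ⟩
    Tr n x + x ^ (2 ℕ.^ n) + x + x         ≈⟨ x+y+y≈x _ _ ⟩
    Tr n x + x ^ (2 ℕ.^ n)                 ∎

  -- Additive Hilbert 90: this solves w² + w = u when Tr n u = 0 and Tr n θ = 1.
  hilbertSum : ℕ → Carrier → Carrier → Carrier
  hilbertSum zero    u θ = 0#
  hilbertSum (suc n) u θ = hilbertSum n u θ + Tr n u * θ ^ (2 ℕ.^ n)

  -- Stated without conditions on the traces so that induction on n goes through; Tr n u = 0 and Tr
  -- n θ = 1 reduce the right-hand side to u.
  hilbertSum-artinSchreier : ∀ n u θ → let w = hilbertSum n u θ in
    w ^ 2 + w ≈ Tr n u * θ ^ (2 ℕ.^ n) + u * Tr n θ ^ 2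
  hilbertSum-artinSchreier zero u θ = begin
    0# ^ 2 + 0#                     ≈⟨ +-identityʳ _ ⟩
    0# * (0# * 1#)                  ≈⟨ zeroˡ _ ⟩
    0#                              ≈⟨ x+x≈0 0# ⟨
    0# + 0#                         ≈⟨ +-cong (zeroˡ _) (trans (*-congˡ (zeroˡ _)) (zeroʳ u)) ⟨
    0# * θ ^ 1 + u * 0# ^ 2         ∎
  hilbertSum-artinSchreier (suc n) u θ = begin
    (w + s * p) ^ 2 + (w + s * p)              ≈⟨ +-congʳ (^2-+ _ _) ⟩
    w ^ 2 + (s * p) ^ 2 + (w + s * p)
      ≈⟨ solve 3 (λ w s p → w :^ 2 :+ (s :* p) :^ 2 :+ (w :+ s :* p)
                          := (w :^ 2 :+ w) :+ (s :* p) :^ 2 :+ s :* p) refl w s p ⟩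
    (w ^ 2 + w) + (s * p) ^ 2 + s * p          ≈⟨ +-congʳ (+-congʳ (hilbertSum-artinSchreier n u θ)) ⟩
    (s * p + u * t ^ 2) + (s * p) ^ 2 + s * p
      ≈⟨ solve 4 (λ s p u t → (s :* p :+ u :* t :^ 2) :+ (s :* p) :^ 2 :+ s :* p
                 := u :* t :^ 2 :+ (s :* p) :^ 2 :+ s :* p :+ s :* p) refl s p u t ⟩
    u * t ^ 2 + (s * p) ^ 2 + s * p + s * p    ≈⟨ x+y+y≈x _ _ ⟩
    -- Adding `u * p ^ 2` twice changes nothing, but one copy completes the trace of u and the other
    -- the squared trace of θ.
    u * t ^ 2 + (s * p) ^ 2                    ≈⟨ x+y+y≈x _ _ ⟨
    u * t ^ 2 + (s * p) ^ 2 + u * p ^ 2 + u * p ^ 2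
      ≈⟨ solve 4 (λ s p u t → u :* t :^ 2 :+ (s :* p) :^ 2 :+ u :* p :^ 2 :+ u :* p :^ 2
                 := (u :+ s :^ 2) :* p :^ 2 :+ u :* (t :^ 2 :+ p :^ 2)) refl s p u t ⟩
    (u + s ^ 2) * p ^ 2 + u * (t ^ 2 + p ^ 2)
      ≈⟨ +-cong (*-cong (sym (Tr-recurrence n u)) p^2) (*-congˡ t^2) ⟩
    Tr (suc n) u * θ ^ (2 ℕ.^ suc n) + u * Tr (suc n) θ ^ 2 ∎
    where
    w = hilbertSum n u θ
    s = Tr n u
    t = Tr n θ
    p = θ ^ (2 ℕ.^ n)
    p^2 : p ^ 2 ≈ θ ^ (2 ℕ.^ suc n)
    p^2 = trans (^-swap θ (2 ℕ.^ n) 2) (sym (^2^suc n θ))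
    t^2 : t ^ 2 + p ^ 2 ≈ Tr (suc n) θ ^ 2
    t^2 = trans (sym (^2-+ t p)) (^-congˡ 2 (sym (Tr-last n θ)))

  artinSchreier-solvable : ∀ n {u θ} → Tr n u ≈ 0# → Tr n θ ≈ 1# → ∃ λ w → w ^ 2 + w ≈ u
  artinSchreier-solvable n {u} {θ} Tr-u≈0 Tr-θ≈1 = hilbertSum n u θ , (begin
    hilbertSum n u θ ^ 2 + hilbertSum n u θ       ≈⟨ hilbertSum-artinSchreier n u θ ⟩
    Tr n u * θ ^ (2 ℕ.^ n) + u * Tr n θ ^ 2
      ≈⟨ +-cong (*-congʳ Tr-u≈0) (*-congˡ (trans (^-congˡ 2 Tr-θ≈1) (1^n≈1 2))) ⟩
    0# * θ ^ (2 ℕ.^ n) + u * 1#                   ≈⟨ +-cong (zeroˡ _) (*-identityʳ u) ⟩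
    0# + u                                        ≈⟨ +-identityˡ u ⟩
    u                                             ∎)

-- Conjugation over the subfield with q elements, and the group μ.

-- q is written as 2 + e so that q ∸ 1 computes to suc e.
module QuadraticExtension {c ℓ} (L : Field c ℓ) (m e : ℕ)
  (q≡2^m : 2 ℕ.+ e ≡ 2 ℕ.^ m) (order : HasOrder L ((2 ℕ.+ e) ℕ.^ 2)) where
  open Field L hiding (zero)
  open FieldProperties L
  open FiniteField L
  open FieldNotions L
  open Solver commutativeSemiring
  open import Relation.Binary.Reasoning.Setoid setoid

  private
    q : ℕ
    q = 2 ℕ.+ e

    1+1≈0 : CharTwo L
    1+1≈0 = charTwo (m ℕ.* 2) (≡.subst (HasOrder L)
      (≡.trans (≡.cong (ℕ._^ 2) q≡2^m) (ℕ.^-*-assoc 2 m 2)) order)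

  open CharacteristicTwo L 1+1≈0

  _==_ : Decidable _≈_
  _==_ = _≟_ order

  infix 9 _ᵠ
  _ᵠ : Carrier → Carrier
  x ᵠ = x ^ q

  ᵠ-cong : ∀ {x y} → x ≈ y → x ᵠ ≈ y ᵠ
  ᵠ-cong = ^-congˡ q

  ᵠ-+ : ∀ x y → (x + y) ᵠ ≈ x ᵠ + y ᵠ
  ᵠ-+ x y = begin
    (x + y) ^ q                    ≈⟨ ^-congʳ _ q≡2^m ⟩
    (x + y) ^ (2 ℕ.^ m)            ≈⟨ ^2^-+ m x y ⟩
    x ^ (2 ℕ.^ m) + y ^ (2 ℕ.^ m)  ≈⟨ +-cong (^-congʳ x q≡2^m) (^-congʳ y q≡2^m) ⟨
    x ^ q + y ^ q                  ∎

  ᵠ-* : ∀ x y → (x * y) ᵠ ≈ x ᵠ * y ᵠ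
  ᵠ-* x y = ^-distrib-* x y q

  ᵠ-^ : ∀ x n → (x ^ n) ᵠ ≈ x ᵠ ^ n
  ᵠ-^ x n = ^-swap x n q

  ᵠ-⁻¹ : ∀ {x} → ¬ (x ≈ 0#) → (x ⁻¹) ᵠ ≈ x ᵠ ⁻¹
  ᵠ-⁻¹ = ⁻¹-^ q

  ᵠ-involutive : ∀ x → x ᵠ ᵠ ≈ x
  ᵠ-involutive x = begin
    (x ^ q) ^ q    ≈⟨ ^-assocʳ x q q ⟩
    x ^ (q ℕ.* q)  ≈⟨ ^-congʳ x (≡.cong (q ℕ.*_) (ℕ.*-identityʳ q)) ⟨
    x ^ (q ℕ.^ 2)  ≈⟨ x^n≈x order x ⟩
    x              ∎

  eval-cong : ∀ B {x y} → x ≈ y → eval B x ≈ eval B y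
  eval-cong []      x≈y = refl
  eval-cong (c ∷ B) x≈y = +-congˡ (*-cong x≈y (eval-cong B x≈y))

  eval-ᵠ : ∀ B x → eval B x ᵠ ≈ eval (B ⁽ q ⁾) (x ᵠ)
  eval-ᵠ []      x = zeroˡ _
  eval-ᵠ (c ∷ B) x = trans (ᵠ-+ _ _) (+-congˡ (trans (ᵠ-* _ _) (*-congˡ (eval-ᵠ B x))))

  -- Telescoping stops at z^q because q = 2^m, so the trace of t measures how far z is from being
  -- fixed by conjugation.
  Tr-artinSchreier : ∀ {z t} → z ^ 2 + z ≈ t → z ᵠ + z ≈ Tr m t
  Tr-artinSchreier {z} {t} z²+z≈t = begin
    z ^ q + z            ≈⟨ +-congʳ (^-congʳ z q≡2^m) ⟩
    z ^ (2 ℕ.^ m) + z    ≈⟨ Tr-x²+x m z ⟨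
    Tr m (z ^ 2 + z)     ≈⟨ Tr-cong m z²+z≈t ⟩
    Tr m t               ∎

  μ⇒≉0 : ∀ {y} → μ (suc q) y → ¬ (y ≈ 0#)
  μ⇒≉0 = unit⇒≉0

  -- `y ^ suc q` unfolds to `y * y ᵠ`, so on μ conjugation is inversion.
  μ⇒ᵠ≈⁻¹ : ∀ {y} → μ (suc q) y → y ᵠ ≈ y ⁻¹
  μ⇒ᵠ≈⁻¹ = ⁻¹-unique

  -- `x * x ^ suc e` is `x ᵠ` by definition, so multiplying the norm of y by the norm of x gives the
  -- norm of `x ᵠ`, which is again that of x.
  x^[q-1]∈μ : ∀ {x} → ¬ (x ≈ 0#) → μ (suc q) (x ^ suc e)
  x^[q-1]∈μ {x} x≉0 = *-cancelˡ-≉0 (*-≉0 x≉0 (^-≉0 q x≉0)) (begin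
    x * x ᵠ * (y * y ᵠ)    ≈⟨ solve 4 (λ x x̄ y ȳ → x :* x̄ :* (y :* ȳ) := x :* y :* (x̄ :* ȳ)) refl x (x ᵠ) y (y ᵠ) ⟩
    x ᵠ * (x ᵠ * y ᵠ)       ≈⟨ *-congˡ (ᵠ-* x y) ⟨
    x ᵠ * x ᵠ ᵠ             ≈⟨ *-congˡ (ᵠ-involutive x) ⟩
    x ᵠ * x               ≈⟨ trans (*-comm _ _) (sym (*-identityʳ _)) ⟩
    x * x ᵠ * 1#          ∎)
    where y = x ^ suc e

  -- Multiplicative Hilbert 90 with the explicit witness x = 1 + y^q: its conjugate 1 + y equals x
  -- y. For y = 1 this x is zero, hence the separate case.
  μ⇒x^[q-1] : ∀ {y} → μ (suc q) y → ∃ λ x → ¬ (x ≈ 0#) × x ^ suc e ≈ y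
  μ⇒x^[q-1] {y} y∈μ with y == 1#
  ... | yes y≈1 = 1# , 0≉1 ∘ sym , trans (1^n≈1 (suc e)) (sym y≈1)
  ... | no y≉1 = x , x≉0 , *-cancelˡ-≉0 x≉0 (begin
      (1# + y ᵠ) ᵠ          ≈⟨ ᵠ-+ 1# (y ᵠ) ⟩
      1# ᵠ + y ᵠ ᵠ           ≈⟨ +-cong (trans (1^n≈1 q) (sym y∈μ)) (ᵠ-involutive y) ⟩
      y * y ᵠ + y          ≈⟨ +-comm _ _ ⟩
      y + y * y ᵠ          ≈⟨ +-cong (*-identityˡ y) (*-comm _ _) ⟨
      1# * y + y ᵠ * y     ≈⟨ distribʳ y 1# (y ᵠ) ⟨
      (1# + y ᵠ) * y       ∎)
    where
    x = 1# + y ᵠ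
    x≉0 : ¬ (x ≈ 0#)
    x≉0 x≈0 = y≉1 (begin
      y          ≈⟨ *-identityʳ y ⟨
      y * 1#     ≈⟨ *-congˡ (x+y≈0⇒x≈y x≈0) ⟩
      y * y ᵠ     ≈⟨ y∈μ ⟩
      1#         ∎)

  -- Roots in μ of the quadratic factor, and the trace condition.

  -- With z = a y / β, the equation a y² + β y + a ᵠ = 0 becomes z² + z = t, and y y ᵠ = 1
  -- becomes z z ᵠ = t; together they amount to z ᵠ = z + 1, that is Tr t = 1.
  module QuadraticFactor (a β : Carrier) (a̅≉a : ¬ (a ᵠ ≈ a)) (β̅≈β : β ᵠ ≈ β) (β≉0 : ¬ (β ≈ 0#)) where

    P : Carrier → Carrier
    P y = a * y ^ 2 + β * y + a ᵠ

    P-cong : ∀ {x y} → x ≈ y → P x ≈ P y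
    P-cong x≈y = +-congʳ (+-cong (*-congˡ (^-congˡ 2 x≈y)) (*-congˡ x≈y))

    t : Carrier
    t = a ^ suc q / β ^ 2

    private
      i : Carrier
      i = β ⁻¹
      βi≈1 : β * i ≈ 1#
      βi≈1 = ⁻¹-inverseʳ β≉0
      i̅≈i : i ᵠ ≈ i
      i̅≈i = trans (ᵠ-⁻¹ β≉0) (⁻¹-cong β̅≈β)
      i≉0 : ¬ (i ≈ 0#)
      i≉0 = unit⇒≉0 (trans (*-comm _ _) βi≈1)

    a≉0 : ¬ (a ≈ 0#)
    a≉0 a≈0 = a̅≉a (trans (*-congʳ a≈0) (trans (zeroˡ _) (sym a≈0)))

    t≈ : t ≈ a * a ᵠ * i ^ 2
    t≈ = *-congˡ (sym (⁻¹-^ 2 β≉0))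

    root⇒Tr≈1 : ∀ {y} → μ (suc q) y → P y ≈ 0# → Tr m t ≈ 1#
    root⇒Tr≈1 {y} y∈μ Py≈0 = trans (sym (Tr-artinSchreier z²+z≈t)) (trans (+-comm _ _) z+z̄≈1)
      where
      z : Carrier
      z = a * y * i
      z≉0 : ¬ (z ≈ 0#)
      z≉0 = *-≉0 (*-≉0 a≉0 (μ⇒≉0 y∈μ)) i≉0
      z²+z≈t : z ^ 2 + z ≈ t
      z²+z≈t = x+y≈0⇒x≈y (begin
        z ^ 2 + z + t                                       ≈⟨ +-cong (+-congˡ (trans (*-congˡ βi≈1) (*-identityʳ z))) (sym t≈) ⟨
        z ^ 2 + z * (β * i) + a * a ᵠ * i ^ 2
          ≈⟨ solve 5 (λ a ā y β i → (a :* y :* i) :^ 2 :+ a :* y :* i :* (β :* i) :+ a :* ā :* i :^ 2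
                := a :* i :^ 2 :* (a :* y :^ 2 :+ β :* y :+ ā)) refl a (a ᵠ) y β i ⟩
        a * i ^ 2 * P y                                     ≈⟨ *-congˡ Py≈0 ⟩
        a * i ^ 2 * 0#                                      ≈⟨ zeroʳ _ ⟩
        0#                                                  ∎)
      zz̄≈t : z * z ᵠ ≈ t
      zz̄≈t = begin
        z * z ᵠ                                 ≈⟨ *-congˡ (trans (ᵠ-* _ _) (*-cong (ᵠ-* a y) i̅≈i)) ⟩
        a * y * i * (a ᵠ * y ᵠ * i)
          ≈⟨ solve 5 (λ a ā y ȳ i → a :* y :* i :* (ā :* ȳ :* i) := a :* ā :* i :^ 2 :* (y :* ȳ))
               refl a (a ᵠ) y (y ᵠ) i ⟩
        a * a ᵠ * i ^ 2 * (y * y ᵠ)              ≈⟨ *-cong (sym t≈) y∈μ ⟩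
        t * 1#                                 ≈⟨ *-identityʳ t ⟩
        t                                      ∎
      z+z̄≈1 : z + z ᵠ ≈ 1#
      -- Both `z * z ᵠ` and `z ^ 2 + z` equal t; comparing them and dividing by z gives the claim.
      z+z̄≈1 = *-cancelˡ-≉0 z≉0 (begin
        z * (z + z ᵠ)          ≈⟨ distribˡ _ _ _ ⟩
        z * z + z * z ᵠ        ≈⟨ +-congˡ (trans zz̄≈t (sym z²+z≈t)) ⟩
        z * z + (z ^ 2 + z)   ≈⟨ solve 1 (λ z → z :* z :+ (z :^ 2 :+ z) := z :+ z :^ 2 :+ z :^ 2) refl z ⟩
        z + z ^ 2 + z ^ 2     ≈⟨ x+y+y≈x _ _ ⟩
        z                     ≈⟨ *-identityʳ z ⟨
        z * 1#                ∎)

    -- Since δ + δ ᵠ = 1, the element t + δ² + δ has trace zero, and t itself serves as θ.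
    Tr≈1⇒z²+z≈t : Tr m t ≈ 1# → ∃ λ z → z ^ 2 + z ≈ t
    Tr≈1⇒z²+z≈t Tr-t≈1 = δ + w , (begin
      (δ + w) ^ 2 + (δ + w)              ≈⟨ +-congʳ (^2-+ δ w) ⟩
      δ ^ 2 + w ^ 2 + (δ + w)
        ≈⟨ solve 4 (λ s r δ w → s :+ r :+ (δ :+ w) := (r :+ w) :+ (s :+ δ)) refl (δ ^ 2) (w ^ 2) δ w ⟩
      (w ^ 2 + w) + (δ ^ 2 + δ)          ≈⟨ +-congʳ w²+w≈u ⟩
      t + (δ ^ 2 + δ) + (δ ^ 2 + δ)      ≈⟨ x+y+y≈x _ _ ⟩
      t                                  ∎)
      where
      s δ : Carrier
      s = a + a ᵠ
      -- The denominator is fixed by conjugation, and it is nonzero because a is not; hence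
      -- `δ ᵠ + δ` is s / s.
      δ = a * s ⁻¹
      s≉0 : ¬ (s ≈ 0#)
      s≉0 s≈0 = a̅≉a (sym (x+y≈0⇒x≈y s≈0))
      s̅≈s : s ᵠ ≈ s
      s̅≈s = trans (ᵠ-+ _ _) (trans (+-congˡ (ᵠ-involutive a)) (+-comm _ _))
      δ̅+δ≈1 : δ ᵠ + δ ≈ 1#
      δ̅+δ≈1 = begin
        δ ᵠ + δ                      ≈⟨ +-congʳ (trans (ᵠ-* _ _) (*-congˡ (trans (ᵠ-⁻¹ s≉0) (⁻¹-cong s̅≈s)))) ⟩
        a ᵠ * s ⁻¹ + a * s ⁻¹        ≈⟨ trans (+-comm _ _) (sym (distribʳ _ _ _)) ⟩
        s * s ⁻¹                    ≈⟨ ⁻¹-inverseʳ s≉0 ⟩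
        1#                          ∎
      Tr-u≈0 : Tr m (t + (δ ^ 2 + δ)) ≈ 0#
      Tr-u≈0 = begin
        Tr m (t + (δ ^ 2 + δ))          ≈⟨ Tr-+ m _ _ ⟩
        Tr m t + Tr m (δ ^ 2 + δ)       ≈⟨ +-cong Tr-t≈1 (trans (sym (Tr-artinSchreier refl)) δ̅+δ≈1) ⟩
        1# + 1#                         ≈⟨ 1+1≈0 ⟩
        0#                              ∎
      solution = artinSchreier-solvable m Tr-u≈0 Tr-t≈1
      w = proj₁ solution
      w²+w≈u = proj₂ solution

    -- The substitution is inverted by y = β z / a. Trace one gives `z ᵠ` = 1 + z, so z has norm t
    -- and y has norm β² t / a^(q+1) = 1.
    z²+z≈t⇒root : Tr m t ≈ 1# → ∀ {z} → z ^ 2 + z ≈ t → ∃ λ y → μ (suc q) y × P y ≈ 0#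
    z²+z≈t⇒root Tr-t≈1 {z} z²+z≈t = β * z * j , y∈μ , Py≈0
      where
      j : Carrier
      j = a ⁻¹
      aj≈1 : a * j ≈ 1#
      aj≈1 = ⁻¹-inverseʳ a≉0
      a̅j̅≈1 : a ᵠ * j ᵠ ≈ 1#
      a̅j̅≈1 = trans (sym (ᵠ-* a j)) (trans (ᵠ-cong aj≈1) (1^n≈1 q))
      1*1≈1 : ∀ {x y} → x ≈ 1# → y ≈ 1# → x * y ≈ 1#
      1*1≈1 x≈1 y≈1 = trans (*-cong x≈1 y≈1) (*-identityʳ 1#)
      z̅≈z+1 : z ᵠ ≈ 1# + z
      z̅≈z+1 = x+y≈z⇒x≈z+y (trans (Tr-artinSchreier z²+z≈t) Tr-t≈1)
      zz̅≈t : z * z ᵠ ≈ t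
      zz̅≈t = begin
        z * z ᵠ           ≈⟨ *-congˡ z̅≈z+1 ⟩
        z * (1# + z)     ≈⟨ trans (distribˡ _ _ _) (+-congʳ (*-identityʳ z)) ⟩
        z + z * z        ≈⟨ solve 1 (λ z → z :+ z :* z := z :^ 2 :+ z) refl z ⟩
        z ^ 2 + z        ≈⟨ z²+z≈t ⟩
        t                ∎
      y∈μ : β * z * j * (β * z * j) ᵠ ≈ 1#
      y∈μ = begin
        β * z * j * (β * z * j) ᵠ     ≈⟨ *-congˡ (trans (ᵠ-* _ _) (*-congʳ (trans (ᵠ-* _ _) (*-congʳ β̅≈β)))) ⟩
        β * z * j * (β * z ᵠ * j ᵠ)
          ≈⟨ solve 5 (λ β z z̅ j j̅ → β :* z :* j :* (β :* z̅ :* j̅) := β :* β :* j :* j̅ :* (z :* z̅)) refl β z (z ᵠ) j (j ᵠ) ⟩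
        β * β * j * j ᵠ * (z * z ᵠ)    ≈⟨ *-congˡ (trans zz̅≈t t≈) ⟩
        β * β * j * j ᵠ * (a * a ᵠ * i ^ 2)
          ≈⟨ solve 6 (λ β j j̅ a a̅ i → β :* β :* j :* j̅ :* (a :* a̅ :* i :^ 2)
                := (β :* i) :* (β :* i) :* ((a :* j) :* (a̅ :* j̅))) refl β j (j ᵠ) a (a ᵠ) i ⟩
        (β * i) * (β * i) * ((a * j) * (a ᵠ * j ᵠ)) ≈⟨ 1*1≈1 (1*1≈1 βi≈1 βi≈1) (1*1≈1 aj≈1 a̅j̅≈1) ⟩
        1#                           ∎
      Py≈0 : P (β * z * j) ≈ 0#
      -- The first two terms of P add up to `a ᵠ`, which the constant term cancels in characteristic
      -- two.
      Py≈0 = trans (+-congʳ (begin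
        a * (β * z * j) ^ 2 + β * (β * z * j)
          ≈⟨ +-cong (solve 4 (λ a β z j → a :* (β :* z :* j) :^ 2 := β :^ 2 :* j :* z :^ 2 :* (a :* j)) refl a β z j)
                    (solve 3 (λ β z j → β :* (β :* z :* j) := β :^ 2 :* j :* z) refl β z j) ⟩
        β ^ 2 * j * z ^ 2 * (a * j) + β ^ 2 * j * z      ≈⟨ +-congʳ (trans (*-congˡ aj≈1) (*-identityʳ _)) ⟩
        β ^ 2 * j * z ^ 2 + β ^ 2 * j * z                ≈⟨ distribˡ _ _ _ ⟨
        β ^ 2 * j * (z ^ 2 + z)                          ≈⟨ *-congˡ (trans z²+z≈t t≈) ⟩
        β ^ 2 * j * (a * a ᵠ * i ^ 2)
          ≈⟨ solve 5 (λ β j a a̅ i → β :^ 2 :* j :* (a :* a̅ :* i :^ 2)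
                := a̅ :* ((β :* i) :* (β :* i) :* (a :* j))) refl β j a (a ᵠ) i ⟩
        a ᵠ * ((β * i) * (β * i) * (a * j))               ≈⟨ *-congˡ (1*1≈1 (1*1≈1 βi≈1 βi≈1) aj≈1) ⟩
        a ᵠ * 1#                                          ≈⟨ *-identityʳ _ ⟩
        a ᵠ                                               ∎)) (x+x≈0 _)

    Tr≈1⇒root : Tr m t ≈ 1# → ∃ λ y → μ (suc q) y × P y ≈ 0#
    Tr≈1⇒root Tr-t≈1 = z²+z≈t⇒root Tr-t≈1 (proj₂ (Tr≈1⇒z²+z≈t Tr-t≈1))

    -- Conjugation swaps the outer coefficients, fixes β and inverts y; multiplying by y² reverses
    -- the order of the terms again.
    y²P̅≈P : ∀ {y} → μ (suc q) y → y ^ 2 * P y ᵠ ≈ P y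
    y²P̅≈P {y} y∈μ = begin
      y ^ 2 * P y ᵠ                                ≈⟨ *-congˡ (ᵠ-+ _ _) ⟩
      y ^ 2 * ((a * y ^ 2 + β * y) ᵠ + a ᵠ ᵠ)      ≈⟨ *-congˡ (+-cong (ᵠ-+ _ _) (ᵠ-involutive a)) ⟩
      y ^ 2 * ((a * y ^ 2) ᵠ + (β * y) ᵠ + a)
        ≈⟨ *-congˡ (+-congʳ (+-cong (trans (ᵠ-* _ _) (*-congˡ (ᵠ-^ y 2)))
                                    (trans (ᵠ-* _ _) (*-congʳ β̅≈β)))) ⟩
      y ^ 2 * (a ᵠ * y ᵠ ^ 2 + β * y ᵠ + a)
        ≈⟨ solve 5 (λ a a̅ β y y̅ → y :^ 2 :* (a̅ :* y̅ :^ 2 :+ β :* y̅ :+ a)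
             := a :* y :^ 2 :+ β :* y :* (y :* y̅) :+ a̅ :* (y :* y̅) :^ 2) refl a (a ᵠ) β y (y ᵠ) ⟩
      a * y ^ 2 + β * y * (y * y ᵠ) + a ᵠ * (y * y ᵠ) ^ 2
        ≈⟨ +-cong (+-congˡ (trans (*-congˡ y∈μ) (*-identityʳ _)))
                  (trans (*-congˡ (trans (^-congˡ 2 y∈μ) (1^n≈1 2))) (*-identityʳ _)) ⟩
      P y                                          ∎

    -- Necessity of the two conditions, and the action of f on (q-1)-st powers.

    module PermutationCriterion (r s : ℕ) (s>0 : s > 0) (s≡r+2 : s % suc q ≡ (r ℕ.+ 2) % suc q)
      (B : Poly) (B≉0 : ∀ x → μ (suc q) x → ¬ (eval B x ≈ 0#)) where

      H : Carrier → Carrier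
      H y = eval B y * P y

      H-cong : ∀ {x y} → x ≈ y → H x ≈ H y
      H-cong x≈y = *-cong (eval-cong B x≈y) (P-cong x≈y)

      f g : Carrier → Carrier
      f x = x ^ s * eval B (x ^ suc e) * (a * x ^ (2 ℕ.* suc e) + β * x ^ suc e + a ^ q)
      g y = y ^ r * eval (B ⁽ q ⁾) (1# / y) / eval B y

      f≈ : ∀ x → f x ≈ x ^ s * H (x ^ suc e)
      f≈ x = trans (*-congˡ (+-congʳ (+-congʳ (*-congˡ
        (trans (sym (^-assocʳ x 2 (suc e))) (^-swap x 2 (suc e))))))) (*-assoc _ _ _)

      f-cong : ∀ {x y} → x ≈ y → f x ≈ f y
      f-cong {x} {y} x≈y = begin
        f x                       ≈⟨ f≈ x ⟩
        x ^ s * H (x ^ suc e)     ≈⟨ *-cong (^-congˡ s x≈y) (H-cong (^-congˡ (suc e) x≈y)) ⟩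
        y ^ s * H (y ^ suc e)     ≈⟨ f≈ y ⟨
        f y                       ∎

      f-zero : ∀ {x} → x ≈ 0# → f x ≈ 0#
      f-zero {x} x≈0 = trans (f≈ x) (trans (*-congʳ (0^n≈0 s>0 x≈0)) (zeroˡ _))

      injective⇒P≉0 : Injective _≈_ _≈_ f → ∀ {y} → μ (suc q) y → ¬ (P y ≈ 0#)
      injective⇒P≉0 f-inj {y} y∈μ Py≈0 = let (x , x≉0 , x^≈y) = μ⇒x^[q-1] y∈μ in
        x≉0 (f-inj (begin
          f x                        ≈⟨ f≈ x ⟩
          x ^ s * H (x ^ suc e)      ≈⟨ *-congˡ (*-congˡ (trans (P-cong x^≈y) Py≈0)) ⟩
          x ^ s * (eval B _ * 0#)    ≈⟨ trans (*-congˡ (zeroʳ _)) (zeroʳ _) ⟩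
          0#                         ≈⟨ f-zero refl ⟨
          f 0#                       ∎))

      injective⇒Tr≉1 : Injective _≈_ _≈_ f → ¬ (Tr m t ≈ 1#)
      injective⇒Tr≉1 f-inj Tr≈1 = let (_ , y∈μ , Py≈0) = Tr≈1⇒root Tr≈1 in
        injective⇒P≉0 f-inj y∈μ Py≈0

      q²≡1+[q-1][q+1] : q ℕ.^ 2 ≡ suc (suc e ℕ.* suc q)
      q²≡1+[q-1][q+1] = ℕS.solve 1 (λ e → (ℕS.con 2 ℕS.:+ e) ℕS.:^ 2 ℕS.:= ℕS.con 1 ℕS.:+
        (ℕS.con 1 ℕS.:+ e) ℕS.:* (ℕS.con 3 ℕS.:+ e)) ≡.refl e
        where module ℕS = ℕSolver.+-*-Solver

      commonDivisor≡1 : Injective _≈_ _≈_ f → ∀ d → d ∣ s → d ∣ suc e → d ≡ 1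
      -- Zero divides only zero, while q - 1 is positive.
      commonDivisor≡1 f-inj zero d∣s (divides k q-1≡k0) =
        ⊥-elim (ℕ.1+n≢0 (≡.trans q-1≡k0 (ℕ.*-zeroʳ k)))
      commonDivisor≡1 f-inj (suc zero) d∣s d∣q-1 = ≡.refl
      commonDivisor≡1 f-inj (suc (suc d)) d∣s d∣q-1 = ⊥-elim (ω≉1 (f-inj (begin
        f ω                        ≈⟨ f≈ ω ⟩
        ω ^ s * H (ω ^ suc e)      ≈⟨ *-cong (^-≈ d∣s) (H-cong (^-≈ d∣q-1)) ⟩
        1# ^ s * H (1# ^ suc e)    ≈⟨ f≈ 1# ⟨
        f 1#                       ∎)))
        where
        -- The root of unity lives in L: d divides q - 1, hence q² - 1, the number of nonzero
        -- elements.
        root = root-of-unity (≡.subst (HasOrder L) q²≡1+[q-1][q+1] order) (s≤s z≤n)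
                 (∣-trans d∣q-1 (m∣m*n (suc q)))
        ω = proj₁ root
        ω≉1 = proj₂ (proj₂ root)
        ^-≈ : ∀ {n} → 2 ℕ.+ d ∣ n → ω ^ n ≈ 1# ^ n
        ^-≈ {n} d∣n = trans (^-∣ d∣n (proj₁ (proj₂ root))) (sym (1^n≈1 n))

      -- Exponents on μ count modulo q + 1, so the congruence for s applies. The extra y² is there
      -- to be absorbed by the power of P.
      y^s≈y^r*y² : ∀ {y} → μ (suc q) y → y ^ s ≈ y ^ r * y ^ 2
      y^s≈y^r*y² {y} y∈μ = begin
        y ^ s                       ≈⟨ x^n≈x^[n%k] q s y∈μ ⟩
        y ^ (s % suc q)             ≈⟨ ^-congʳ y s≡r+2 ⟩
        y ^ ((r ℕ.+ 2) % suc q)     ≈⟨ x^n≈x^[n%k] q (r ℕ.+ 2) y∈μ ⟨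
        y ^ (r ℕ.+ 2)               ≈⟨ ^-homo-* y r 2 ⟩
        y ^ r * y ^ 2               ∎

      P^[q-1] : ∀ {y} → μ (suc q) y → ¬ (P y ≈ 0#) → y ^ 2 * P y ^ suc e ≈ 1#
      P^[q-1] {y} y∈μ Py≉0 = *-cancelˡ-≉0 Py≉0 (begin
        P y * (y ^ 2 * P y ^ suc e)
          ≈⟨ solve 3 (λ p s n → p :* (s :* n) := s :* (p :* n)) refl (P y) (y ^ 2) (P y ^ suc e) ⟩
        y ^ 2 * P y ᵠ                   ≈⟨ y²P̅≈P y∈μ ⟩
        P y                            ≈⟨ *-identityʳ _ ⟨
        P y * 1#                       ∎)

      -- After multiplication by B(y) the left side is the conjugate of B(y), in which the
      -- coefficients are raised to the q-th power and y becomes 1/y.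
      B^[q-1] : ∀ {y} → μ (suc q) y → eval B y ^ suc e ≈ eval (B ⁽ q ⁾) (1# / y) / eval B y
      B^[q-1] {y} y∈μ = *-cancelˡ-≉0 (B≉0 y y∈μ) (begin
        eval B y ᵠ                                   ≈⟨ eval-ᵠ B y ⟩
        eval (B ⁽ q ⁾) (y ᵠ)
          ≈⟨ eval-cong (B ⁽ q ⁾) (trans (μ⇒ᵠ≈⁻¹ y∈μ) (sym (*-identityˡ _))) ⟩
        D                                           ≈⟨ *-identityʳ D ⟨
        D * 1#                                      ≈⟨ *-congˡ (⁻¹-inverseʳ (B≉0 y y∈μ)) ⟨
        D * (E * E ⁻¹)                              ≈⟨ solve 3 (λ d x y → d :* (x :* y) := x :* (d :* y)) refl D E (E ⁻¹) ⟩
        E * (D / E)                                 ∎)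
        where
        D E : Carrier
        D = eval (B ⁽ q ⁾) (1# / y)
        E = eval B y

      -- The power of x^s contributes y^r y², the quadratic factor contributes y^(-2), and the power
      -- of B supplies the quotient in g.
      f^[q-1]≈g : ∀ {x} → let y = x ^ suc e in μ (suc q) y → ¬ (P y ≈ 0#) → f x ^ suc e ≈ g y
      f^[q-1]≈g {x} y∈μ Py≉0 = begin
        f x ^ suc e                                ≈⟨ ^-congˡ (suc e) (f≈ x) ⟩
        (x ^ s * H y) ^ suc e                      ≈⟨ ^-distrib-* _ _ (suc e) ⟩
        (x ^ s) ^ suc e * H y ^ suc e
          ≈⟨ *-cong (trans (^-swap x s (suc e)) (y^s≈y^r*y² y∈μ)) (^-distrib-* _ _ (suc e)) ⟩
        y ^ r * y ^ 2 * (eval B y ^ suc e * P y ^ suc e)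
          ≈⟨ solve 4 (λ u v w z → u :* v :* (w :* z) := u :* w :* (v :* z)) refl
               (y ^ r) (y ^ 2) (eval B y ^ suc e) (P y ^ suc e) ⟩
        y ^ r * eval B y ^ suc e * (y ^ 2 * P y ^ suc e)  ≈⟨ *-congˡ (P^[q-1] y∈μ Py≉0) ⟩
        y ^ r * eval B y ^ suc e * 1#              ≈⟨ *-identityʳ _ ⟩
        y ^ r * eval B y ^ suc e                   ≈⟨ *-congˡ (B^[q-1] y∈μ) ⟩
        y ^ r * (eval (B ⁽ q ⁾) (1# / y) / eval B y)   ≈⟨ *-assoc _ _ _ ⟨
        g y                                        ∎
        where y = x ^ suc e

      -- Sufficiency of the two conditions.

      module Sufficiency
        (g-injective : ∀ {y z} → μ (suc q) y → μ (suc q) z → g y ≈ g z → y ≈ z)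
        (gcd≡1 : gcd s (suc e) ≡ 1) (Tr≉1 : ¬ (Tr m t ≈ 1#)) where

        P≉0 : ∀ {y} → μ (suc q) y → ¬ (P y ≈ 0#)
        P≉0 y∈μ Py≈0 = Tr≉1 (root⇒Tr≈1 y∈μ Py≈0)

        H≉0 : ∀ {y} → μ (suc q) y → ¬ (H y ≈ 0#)
        H≉0 y∈μ = *-≉0 (B≉0 _ y∈μ) (P≉0 y∈μ)

        f≉0 : ∀ {x} → ¬ (x ≈ 0#) → ¬ (f x ≈ 0#)
        f≉0 x≉0 fx≈0 = *-≉0 (^-≉0 s x≉0) (H≉0 (x^[q-1]∈μ x≉0)) (trans (sym (f≈ _)) fx≈0)

        f-injective-≉0 : ∀ {x y} → ¬ (x ≈ 0#) → ¬ (y ≈ 0#) → f x ≈ f y → x ≈ y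
        f-injective-≉0 {x} {y} x≉0 y≉0 fx≈fy = ^-injective-coprime {s} {suc e} gcd≡1 x≉0 eqₛ eq
          where
          x∈μ = x^[q-1]∈μ x≉0
          y∈μ = x^[q-1]∈μ y≉0
          eq : x ^ suc e ≈ y ^ suc e
          eq = g-injective x∈μ y∈μ (begin
            g (x ^ suc e)   ≈⟨ f^[q-1]≈g x∈μ (P≉0 x∈μ) ⟨
            f x ^ suc e     ≈⟨ ^-congˡ (suc e) fx≈fy ⟩
            f y ^ suc e     ≈⟨ f^[q-1]≈g y∈μ (P≉0 y∈μ) ⟩
            g (y ^ suc e)   ∎)
          eqₛ : x ^ s ≈ y ^ s
          -- Once the (q-1)-st powers agree, both values of f carry the same nonzero factor H.
          eqₛ = *-cancelˡ-≉0 (H≉0 x∈μ) (begin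
            H (x ^ suc e) * x ^ s   ≈⟨ trans (*-comm _ _) (sym (f≈ x)) ⟩
            f x                     ≈⟨ fx≈fy ⟩
            f y                     ≈⟨ trans (f≈ y) (*-comm _ _) ⟩
            H (y ^ suc e) * y ^ s   ≈⟨ *-congʳ (H-cong eq) ⟨
            H (x ^ suc e) * y ^ s   ∎)

        f-injective : Injective _≈_ _≈_ f
        f-injective {x} {y} fx≈fy = cases (x == 0#) (y == 0#)
          where
          cases : Dec (x ≈ 0#) → Dec (y ≈ 0#) → x ≈ y
          cases (yes x≈0) (yes y≈0) = trans x≈0 (sym y≈0)
          cases (yes x≈0) (no y≉0)  = ⊥-elim (f≉0 y≉0 (trans (sym fx≈fy) (f-zero x≈0)))
          cases (no x≉0)  (yes y≈0) = ⊥-elim (f≉0 x≉0 (trans fx≈fy (f-zero y≈0)))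
          cases (no x≉0)  (no y≉0)  = f-injective-≉0 x≉0 y≉0 fx≈fy

      permutes⇔ : PermutesOn (μ (suc q)) g →
                  Permutes f ⇔ (gcd s (suc e) ≡ 1 × ¬ (Tr m t ≈ 1#))
      permutes⇔ g-permutes = mk⇔
        (λ (f-inj , _) → commonDivisor≡1 f-inj _ (gcd[m,n]∣m s (suc e)) (gcd[m,n]∣n s (suc e)) ,
                         injective⇒Tr≉1 f-inj)
        -- On a finite field injectivity suffices, so surjectivity of f comes from counting.
        (λ (gcd≡1 , Tr≉1) → injective⇒bijective order f-cong
          (Sufficiency.f-injective
            (λ y∈μ z∈μ → proj₁ (proj₂ g-permutes) {_ , y∈μ} {_ , z∈μ}) gcd≡1 Tr≉1))

-- The subfield K as the fixed points of conjugation.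

module Subfield {c₁ ℓ₁ c₂ ℓ₂} (K : Field c₁ ℓ₁) (L : Field c₂ ℓ₂)
  (ι : Field.Carrier K → Field.Carrier L)
  (ι-mono : IsRingMonomorphism (Field.rawRing K) (Field.rawRing L) ι) where
  module K = Field K
  open Field L hiding (zero)
  open IsRingMonomorphism ι-mono
  open FieldProperties L

  ι-^ : ∀ k n → ι (k K.^ n) ≈ ι k ^ n
  ι-^ k zero    = 1#-homo
  ι-^ k (suc n) = trans (*-homo _ _) (*-congˡ (ι-^ k n))

  ι-≉0 : ∀ {k} → ¬ (k K.≈ K.0#) → ¬ (ι k ≈ 0#)
  ι-≉0 k≉0 ιk≈0 = k≉0 (injective (trans ιk≈0 (sym 0#-homo)))

  ι-fixed : ∀ {q} → HasOrder K q → ∀ k → ι k ^ q ≈ ι k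
  ι-fixed {q} order k = trans (sym (ι-^ k q)) (⟦⟧-cong (FiniteField.x^n≈x K order k))

  -- a and the q elements of K would be q + 1 roots of x ^ q - x.
  ∉ι⇒moved : ∀ {e} → HasOrder K (2 ℕ.+ e) → ∀ {a} → ¬ (∃ λ k → ι k ≈ a) → ¬ (a ^ (2 ℕ.+ e) ≈ a)
  ∉ι⇒moved {e} order {a} a∉K aᵠ≈a = power-fixpoints e xs xs-injective xs-fixed
    where
    xs : Fin (3 ℕ.+ e) → Carrier
    xs zero    = a
    xs (suc i) = ι (Inverse.from order i)
    xs-injective : Injective _≡_ _≈_ xs
    xs-injective {zero}  {zero}  eq = ≡.refl
    xs-injective {zero}  {suc j} eq = ⊥-elim (a∉K (_ , sym eq))
    xs-injective {suc i} {zero}  eq = ⊥-elim (a∉K (_ , eq))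
    xs-injective {suc i} {suc j} eq = ≡.cong suc (FiniteField.from-injective K order (injective eq))
    xs-fixed : ∀ i → xs i ^ (2 ℕ.+ e) ≈ xs i
    xs-fixed zero    = aᵠ≈a
    xs-fixed (suc i) = ι-fixed order _

2^m≢1 : ∀ {m} → m > 0 → 1 ≢ 2 ℕ.^ m
2^m≢1 m>0 = ℕ.<⇒≢ (ℕ.^-monoʳ-< 2 (s≤s (s≤s z≤n)) m>0)

theorem3p5 :
    ∀ {c₁ ℓ₁ c₂ ℓ₂} (q m : ℕ) → m > 0 → q ≡ 2 ℕ.^ m →
    -- K is the field with q elements, L the one with q² elements, and ι
    -- identifies K with a subfield of L
    (K : Field c₁ ℓ₁) → HasOrder K q →
    (L : Field c₂ ℓ₂) → HasOrder L (q ℕ.^ 2) →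
    let module K = Field K
        open Field L
        open FieldNotions L in
    (ι : K.Carrier → Carrier) → IsRingMonomorphism K.rawRing rawRing ι →
    (r s : ℕ) → r > 0 → s > 0 → s % suc q ≡ (r ℕ.+ 2) % suc q →
    (B : Poly) →
    (∀ x → μ (suc q) x → ¬ (eval B x ≈ 0#)) →
    PermutesOn (μ (suc q)) (λ x → x ^ r * eval (B ⁽ q ⁾) (1# / x) / eval B x) →
    (a : Carrier) → ¬ (∃ λ k → ι k ≈ a) →
    (b : K.Carrier) → ¬ (b K.≈ K.0#) →
    Permutes (λ x → x ^ s * eval B (x ^ (q ∸ 1))
                      * (a * x ^ (2 ℕ.* (q ∸ 1)) + ι b * x ^ (q ∸ 1) + a ^ q))
      ⇔ (gcd s (q ∸ 1) ≡ 1 × ¬ (Tr m (a ^ suc q / ι b ^ 2) ≈ 1#))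
-- The values 0 and 1 of q are excluded first: a power of two is nonzero, and it exceeds 1 since m
-- is positive.
theorem3p5 zero m _ 0≡2^m with () ← ℕ.m^n≡0⇒m≡0 2 m (≡.sym 0≡2^m)
theorem3p5 (suc zero) m m>0 1≡2^m = ⊥-elim (2^m≢1 m>0 1≡2^m)
theorem3p5 (suc (suc e)) m _ q≡2^m K K-order L L-order ι ι-mono r s _ s>0 s≡r+2 B B≉0 g-permutes a a∉K b b≉0 =
  permutes⇔ g-permutes
  where
  open Subfield K L ι ι-mono
  open QuadraticExtension L m e q≡2^m L-order
  -- Membership in K is translated into conjugation here: a lies outside K and is moved, b lies in K
  -- and is fixed.
  open QuadraticFactor a (ι b) (∉ι⇒moved K-order a∉K) (ι-fixed K-order b) (ι-≉0 b≉0)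
  open PermutationCriterion r s s>0 s≡r+2 B B≉0
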